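{- Let $G_1$ and $G_2$ be two vertex-disjoint simple connected graphs with $|V(G_1)|=n_1$, $|V(G_2)|=n_2$, $|E(G_1)|=m_1$, $|E(G_2)|=m_2$. Then the vertex Q-join $G_1\dot{\vee}_Q G_2$ satisfies \[ F(G_1\dot{\vee}_Q G_2)=F(G_1)+F(G_2)+3n_2M_1(G_1)+3n_1M_1(G_2)+M_4(G_1)+3\,ReZM(G_1)+6m_1n_2^{2}+6m_2n_1^{2}+n_1n_2(n_1^2+n_2^2). \]
   Context: For a simple graph $G$ and $v\in V(G)$, $d_G(v)$ is the degree of $v$. Define $M_1(G)=\sum_{v\in V(G)}d_G(v)^2$, $F(G)=\sum_{v\in V(G)}d_G(v)^3$, $M_4(G)=\sum_{v\in V(G)}d_G(v)^4$, and $ReZM(G)=\sum_{uv\in E(G)}d_G(u)d_G(v)\,[d_G(u)+d_G(v)]$. The graph $Q(G)$ is obtained from $G$ by inserting a new vertex into each edge of $G$ (subdividing it) and then joining by an edge each pair of new vertices that lie on adjacent edges of $G$ (edges sharing an end vertex); let $I(G)$ denote the set of these new vertices, so $V(Q(G))=V(G)\cup I(G)$. The vertex Q-join $G_1\dot{\vee}_Q G_2$ is the graph obtained from $Q(G_1)$ and $G_2$ (taken vertex-disjoint) by joining each vertex of $V(G_1)$ to every vertex of $G_2$ by an edge. -}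

module Defs where

open import Level using (0ℓ)
open import Data.Empty using (⊥)
open import Data.Fin using (Fin) renaming (_<_ to _<ᶠ_)
open import Data.Fin.Properties using (any?; +↔⊎) renaming (_≟_ to _≟ᶠ_; _<?_ to _<ᶠ?_)
open import Data.List using (List; length; filter; map; lookup; tabulate; cartesianProduct)
open import Data.Nat using (ℕ; _+_; _*_; _^_)
open import Data.Nat.ListAction using (sum)
open import Data.Product using (_×_; _,_; proj₁; proj₂; ∃)
open import Data.Sum using (_⊎_; inj₁; inj₂)
open import Data.Sum.Function.Propositional using (_⊎-↔_)
open import Data.Unit using (⊤; tt)
open import Function using (_↔_; Inverse; _∘_)
open import Function.Properties.Inverse using (↔-refl; ↔-sym; ↔-trans; Inverse⇒Injection)
open import Relation.Binary using (Rel; Decidable; DecidableEquality; Symmetric; Irreflexive)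
open import Relation.Binary.Construct.Closure.ReflexiveTransitive using (Star)
open import Relation.Binary.PropositionalEquality
  using (_≡_; _≢_; refl; subst) renaming (sym to ≡-sym)
open import Relation.Nullary using (yes; no)
open import Relation.Nullary.Decidable using (map′; _×-dec_; _⊎-dec_; ¬?; via-injection)

record SimpleGraph : Set₁ where
  infix 4 _~_ _~?_
  field
    V      : Set
    order  : ℕ
    enum   : V ↔ Fin order
    _~_    : Rel V 0ℓ
    _~?_   : Decidable _~_
    sym    : Symmetric _~_
    irrefl : Irreflexive _≡_ _~_

  index : V → Fin order
  index = Inverse.to enum

  vertices : List V
  vertices = tabulate (Inverse.from enum)

  _≟_ : DecidableEquality V
  _≟_ = via-injection (Inverse⇒Injection enum) _≟ᶠ_

  degree : V → ℕ
  degree v = length (filter (v ~?_) vertices)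

  -- Each edge {u , v} is listed once, as the pair whose first component
  -- has the smaller index.
  edges : List (V × V)
  edges = filter (λ (u , v) → (index u <ᶠ? index v) ×-dec (u ~? v))
                 (cartesianProduct vertices vertices)

  size : ℕ
  size = length edges

  E : Set
  E = Fin size

  endpoints : E → V × V
  endpoints = lookup edges

  infix 4 _∈ₑ_ _∈ₑ?_
  _∈ₑ_ : V → E → Set
  v ∈ₑ e = v ≡ proj₁ (endpoints e) ⊎ v ≡ proj₂ (endpoints e)

  _∈ₑ?_ : Decidable _∈ₑ_
  v ∈ₑ? e = (v ≟ proj₁ (endpoints e)) ⊎-dec (v ≟ proj₂ (endpoints e))

  AdjacentEdges : Rel E 0ℓ
  AdjacentEdges e f = e ≢ f × ∃ λ v → v ∈ₑ e × v ∈ₑ f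

  adjacentEdges? : Decidable AdjacentEdges
  adjacentEdges? e f = ¬? (e ≟ᶠ f) ×-dec
    map′ (λ (i , p) → Inverse.from enum i , p)
         (λ (v , p) → index v ,
           subst (λ w → w ∈ₑ e × w ∈ₑ f) (≡-sym (Inverse.strictlyInverseʳ enum v)) p)
         (any? λ i → (Inverse.from enum i ∈ₑ? e) ×-dec (Inverse.from enum i ∈ₑ? f))

  -- The null graph is not regarded as connected.
  Connected : Set
  Connected = V × (∀ u v → Star _~_ u v)

open SimpleGraph using (V; E; vertices; edges; degree)

M₁ : SimpleGraph → ℕ
M₁ G = sum (map (λ v → degree G v ^ 2) (vertices G))

F : SimpleGraph → ℕ
F G = sum (map (λ v → degree G v ^ 3) (vertices G))

M₄ : SimpleGraph → ℕ
M₄ G = sum (map (λ v → degree G v ^ 4) (vertices G))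

ReZM : SimpleGraph → ℕ
ReZM G = sum (map (λ (u , v) → degree G u * degree G v * (degree G u + degree G v)) (edges G))

module _ (G : SimpleGraph) where
  private module G = SimpleGraph G

  -- inj₂ e is the vertex inserted into the edge e.  Subdivision leaves no
  -- edge between two original vertices.
  QAdj : Rel (V G ⊎ E G) 0ℓ
  QAdj (inj₁ _) (inj₁ _) = ⊥
  QAdj (inj₁ v) (inj₂ e) = v G.∈ₑ e
  QAdj (inj₂ e) (inj₁ v) = v G.∈ₑ e
  QAdj (inj₂ e) (inj₂ f) = G.AdjacentEdges e f

  QAdj? : Decidable QAdj
  QAdj? (inj₁ _) (inj₁ _) = no λ ()
  QAdj? (inj₁ v) (inj₂ e) = v G.∈ₑ? e
  QAdj? (inj₂ e) (inj₁ v) = v G.∈ₑ? e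
  QAdj? (inj₂ e) (inj₂ f) = G.adjacentEdges? e f

  QAdj-sym : Symmetric QAdj
  QAdj-sym {inj₁ _} {inj₂ _} p = p
  QAdj-sym {inj₂ _} {inj₁ _} p = p
  QAdj-sym {inj₂ _} {inj₂ _} (e≢f , v , p , q) = e≢f ∘ ≡-sym , v , q , p

  QAdj-irrefl : Irreflexive _≡_ QAdj
  QAdj-irrefl {inj₂ _} refl (e≢e , _) = e≢e refl

  Q : SimpleGraph
  Q = record
    { V      = V G ⊎ E G
    ; order  = G.order + G.size
    ; enum   = ↔-trans (G.enum ⊎-↔ ↔-refl) (↔-sym +↔⊎)
    ; _~_    = QAdj
    ; _~?_   = QAdj?
    ; sym    = λ {x} {y} → QAdj-sym {x} {y}
    ; irrefl = λ {x} {y} → QAdj-irrefl {x} {y}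
    }

module _ (G₁ G₂ : SimpleGraph) where
  private
    module Q₁ = SimpleGraph (Q G₁)
    module G₂ = SimpleGraph G₂

  -- The disjoint sum makes the two vertex sets disjoint.
  QJoinAdj : Rel (V (Q G₁) ⊎ V G₂) 0ℓ
  QJoinAdj (inj₁ x)        (inj₁ y)        = x Q₁.~ y
  QJoinAdj (inj₂ x)        (inj₂ y)        = x G₂.~ y
  QJoinAdj (inj₁ (inj₁ _)) (inj₂ _)        = ⊤
  QJoinAdj (inj₁ (inj₂ _)) (inj₂ _)        = ⊥
  QJoinAdj (inj₂ _)        (inj₁ (inj₁ _)) = ⊤
  QJoinAdj (inj₂ _)        (inj₁ (inj₂ _)) = ⊥

  QJoinAdj? : Decidable QJoinAdj
  QJoinAdj? (inj₁ x)        (inj₁ y)        = x Q₁.~? y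
  QJoinAdj? (inj₂ x)        (inj₂ y)        = x G₂.~? y
  QJoinAdj? (inj₁ (inj₁ _)) (inj₂ _)        = yes tt
  QJoinAdj? (inj₁ (inj₂ _)) (inj₂ _)        = no λ ()
  QJoinAdj? (inj₂ _)        (inj₁ (inj₁ _)) = yes tt
  QJoinAdj? (inj₂ _)        (inj₁ (inj₂ _)) = no λ ()

  QJoinAdj-sym : Symmetric QJoinAdj
  QJoinAdj-sym {inj₁ x}        {inj₁ y}        p = Q₁.sym {x} {y} p
  QJoinAdj-sym {inj₂ _}        {inj₂ _}        p = G₂.sym p
  QJoinAdj-sym {inj₁ (inj₁ _)} {inj₂ _}        _ = tt
  QJoinAdj-sym {inj₂ _}        {inj₁ (inj₁ _)} _ = tt

  QJoinAdj-irrefl : Irreflexive _≡_ QJoinAdj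
  QJoinAdj-irrefl {inj₁ x} refl p = Q₁.irrefl {x} refl p
  QJoinAdj-irrefl {inj₂ _} refl p = G₂.irrefl refl p

  infixl 6 _∨̇Q_
  _∨̇Q_ : SimpleGraph
  _∨̇Q_ = record
    { V      = V (Q G₁) ⊎ V G₂
    ; order  = Q₁.order + G₂.order
    ; enum   = ↔-trans (Q₁.enum ⊎-↔ G₂.enum) (↔-sym +↔⊎)
    ; _~_    = QJoinAdj
    ; _~?_   = QJoinAdj?
    ; sym    = λ {x} {y} → QJoinAdj-sym {x} {y}
    ; irrefl = λ {x} {y} → QJoinAdj-irrefl {x} {y}
    }

{-# OPTIONS --safe #-}
-- In G₁ ∨̇Q G₂ a vertex v of G₁ has degree d(v) + n₂, a vertex w of G₂ has degree d(w) + n₁, and the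
-- vertex inserted into an edge uv of G₁ has degree d(u) + d(v): two neighbours u and v, plus the
-- (d(u) − 1) + (d(v) − 1) edges meeting uv.  Expanding the cubes leaves, besides the invariants,
-- Σ d(v) = 2m and Σ_{uv} (d(u)³ + d(v)³) = M₄, both instances of the weighted handshake identity
-- Σ_{uv} (h(u) + h(v)) = Σ_v d(v) h(v), which with h the indicator of v also shows that v lies on d(v) edges.
module Submission where

open import Defs
open import Algebra.Properties.CommutativeSemigroup using (interchange)
open import Data.Bool using (true; false; if_then_else_)
open import Data.Empty using (⊥-elim)
open import Data.Fin using (Fin; zero; suc; _↑ˡ_; _↑ʳ_) renaming (_<_ to _<ᶠ_)
open import Data.Fin.Properties using (<-cmp; <-asym; +↔⊎; splitAt-↑ˡ; splitAt-↑ʳ) renaming (_≟_ to _≟ᶠ_; _<?_ to _<ᶠ?_)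
open import Data.List using (List; []; _∷_; _++_; map; filter; length; lookup; tabulate; allFin; cartesianProduct)
open import Data.List.Membership.Propositional using (_∈_)
open import Data.List.Membership.Propositional.Properties using (∈-lookup; ∈-filter⁻; ∈-tabulate⁺; ∈-allFin)
open import Data.List.Properties using (map-++; map-∘; map-cong; map-tabulate; tabulate-lookup; tabulate-cong; length-tabulate)
open import Data.List.Relation.Unary.All as All using (All; []; _∷_)
open import Data.List.Relation.Unary.AllPairs using ([]; _∷_)
open import Data.List.Relation.Unary.Any using (here; there)
open import Data.List.Relation.Unary.Unique.Propositional using (Unique)
open import Data.List.Relation.Unary.Unique.Propositional.Properties using (filter⁺; cartesianProduct⁺; tabulate⁺; allFin⁺)
open import Data.Nat using (ℕ; _+_; _*_; _^_)
open import Data.Nat.ListAction using (sum)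
open import Data.Nat.ListAction.Properties using (sum-++)
open import Data.Nat.Properties using (+-comm; +-commutativeSemigroup; +-identityʳ; *-comm; *-zeroʳ; *-identityˡ; *-identityʳ; *-distribˡ-+; *-distribʳ-+)
open import Data.Nat.Solver using (module +-*-Solver)
open import Data.Product using (_×_; _,_; ∃; proj₁; proj₂)
open import Data.Sum using (_⊎_; inj₁; inj₂; [_,_]′)
open import Data.Sum.Function.Propositional using (_⊎-↔_)
open import Function using (_∘_; _↔_; Inverse)
open import Function.Properties.Inverse using (↔-refl; ↔-sym; ↔-trans)
open import Relation.Binary using (DecidableEquality; tri<; tri≈; tri>)
open import Relation.Binary.PropositionalEquality using (_≡_; _≢_; refl; sym; trans; cong; cong₂; subst; module ≡-Reasoning)
open import Relation.Nullary using (Dec; yes; no; does; ¬_)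
open import Relation.Nullary.Decidable using (dec-true; dec-false; _×-dec_; _⊎-dec_)
open import Relation.Unary using (Pred; Decidable)
open SimpleGraph using (order; size; Connected)
open ≡-Reasoning
open +-*-Solver using (solve; con; _:+_; _:*_; _:^_; _:=_)

-- Finite sums over lists.

private variable
  A B : Set

∑ : List A → (A → ℕ) → ℕ
∑ xs f = sum (map f xs)

syntax ∑ xs (λ x → e) = ∑[ x ∈ xs ] e

∑-cong : ∀ (xs : List A) {f g : A → ℕ} → (∀ x → f x ≡ g x) → ∑ xs f ≡ ∑ xs g
∑-cong xs p = cong sum (map-cong p xs)

∑-map : ∀ (h : A → B) (f : B → ℕ) xs → ∑ (map h xs) f ≡ ∑[ x ∈ xs ] f (h x)
∑-map h f xs = cong sum (sym (map-∘ xs))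

∑-++ : ∀ (xs ys : List A) f → ∑ (xs ++ ys) f ≡ ∑ xs f + ∑ ys f
∑-++ xs ys f = trans (cong sum (map-++ f xs ys)) (sum-++ (map f xs) (map f ys))

∑-0 : ∀ (xs : List A) → ∑[ _ ∈ xs ] 0 ≡ 0
∑-0 []       = refl
∑-0 (_ ∷ xs) = ∑-0 xs

∑-1 : ∀ (xs : List A) → ∑[ _ ∈ xs ] 1 ≡ length xs
∑-1 []       = refl
∑-1 (_ ∷ xs) = cong (1 +_) (∑-1 xs)

∑-+ : ∀ (xs : List A) f g → ∑[ x ∈ xs ] (f x + g x) ≡ ∑ xs f + ∑ xs g
∑-+ []       f g = refl
∑-+ (x ∷ xs) f g = begin
  f x + g x + ∑[ y ∈ xs ] (f y + g y)  ≡⟨ cong (f x + g x +_) (∑-+ xs f g) ⟩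
  f x + g x + (∑ xs f + ∑ xs g)        ≡⟨ interchange +-commutativeSemigroup (f x) (g x) _ _ ⟩
  f x + ∑ xs f + (g x + ∑ xs g)        ∎

∑-*ˡ : ∀ c (xs : List A) f → ∑[ x ∈ xs ] (c * f x) ≡ c * ∑ xs f
∑-*ˡ c []       f = sym (*-zeroʳ c)
∑-*ˡ c (x ∷ xs) f = trans (cong (c * f x +_) (∑-*ˡ c xs f)) (sym (*-distribˡ-+ c _ _))

∑-*ʳ : ∀ c (xs : List A) f → ∑[ x ∈ xs ] (f x * c) ≡ ∑ xs f * c
∑-*ʳ c []       f = refl
∑-*ʳ c (x ∷ xs) f = trans (cong (f x * c +_) (∑-*ʳ c xs f)) (sym (*-distribʳ-+ c (f x) _))

∑-const : ∀ (xs : List A) c → ∑[ _ ∈ xs ] c ≡ length xs * c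
∑-const []       c = refl
∑-const (_ ∷ xs) c = cong (c +_) (∑-const xs c)

∑-swap : ∀ (xs : List A) (ys : List B) (f : A → B → ℕ) →
         ∑[ x ∈ xs ] ∑[ y ∈ ys ] f x y ≡ ∑[ y ∈ ys ] ∑[ x ∈ xs ] f x y
∑-swap []       ys f = sym (∑-0 ys)
∑-swap (x ∷ xs) ys f =
  trans (cong (∑ ys (f x) +_) (∑-swap xs ys f)) (sym (∑-+ ys (f x) _))

∑-cartesianProduct : ∀ (xs : List A) (ys : List B) f →
  ∑ (cartesianProduct xs ys) f ≡ ∑[ x ∈ xs ] ∑[ y ∈ ys ] f (x , y)
∑-cartesianProduct []       ys f = refl
∑-cartesianProduct (x ∷ xs) ys f = begin
  ∑ (map (x ,_) ys ++ cartesianProduct xs ys) f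
    ≡⟨ ∑-++ (map (x ,_) ys) _ f ⟩
  ∑ (map (x ,_) ys) f + ∑ (cartesianProduct xs ys) f
    ≡⟨ cong₂ _+_ (∑-map (x ,_) f ys) (∑-cartesianProduct xs ys f) ⟩
  ∑[ y ∈ ys ] f (x , y) + ∑[ z ∈ xs ] ∑[ y ∈ ys ] f (z , y)  ∎

-- Passes from inserted vertices, which are positions in the list `edges`, to the endpoint pairs
-- stored there, over which the handshake identity is stated.
∑-lookup : ∀ (xs : List A) f → ∑[ i ∈ allFin (length xs) ] f (lookup xs i) ≡ ∑ xs f
∑-lookup xs f = begin
  sum (map (f ∘ lookup xs) (tabulate (λ i → i)))  ≡⟨ cong sum (map-tabulate (λ i → i) (f ∘ lookup xs)) ⟩
  sum (tabulate (f ∘ lookup xs))                  ≡⟨ cong sum (map-tabulate (lookup xs) f) ⟨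
  ∑ (tabulate (lookup xs)) f                      ≡⟨ cong (λ ys → ∑ ys f) (tabulate-lookup xs) ⟩
  ∑ xs f                                          ∎

-- Indicators of decidable propositions.

-- Branches on `does`, as `filter` does, so that degrees and edge sums, both defined by filtering,
-- become sums of indicators.
⟦_⟧ : ∀ {P : Set} → Dec P → ℕ
⟦ P? ⟧ = if does P? then 1 else 0

⟦⟧-true : ∀ {P : Set} (P? : Dec P) → P → ⟦ P? ⟧ ≡ 1
⟦⟧-true P? p = cong (if_then 1 else 0) (dec-true P? p)

⟦⟧-false : ∀ {P : Set} (P? : Dec P) → ¬ P → ⟦ P? ⟧ ≡ 0
⟦⟧-false P? ¬p = cong (if_then 1 else 0) (dec-false P? ¬p)

⟦⟧-⇔ : ∀ {P Q : Set} (P? : Dec P) (Q? : Dec Q) → (P → Q) → (Q → P) → ⟦ P? ⟧ ≡ ⟦ Q? ⟧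
⟦⟧-⇔ (yes p) Q? f g = sym (⟦⟧-true Q? (f p))
⟦⟧-⇔ (no ¬p) Q? f g = sym (⟦⟧-false Q? (¬p ∘ g))

-- Exclusiveness rules out the one case, both true, in which the right side would be 2.
⟦⟧-⊎ : ∀ {P Q : Set} (P? : Dec P) (Q? : Dec Q) → (P → ¬ Q) → ⟦ P? ⊎-dec Q? ⟧ ≡ ⟦ P? ⟧ + ⟦ Q? ⟧
⟦⟧-⊎ (yes p) (yes q) ¬pq = ⊥-elim (¬pq p q)
⟦⟧-⊎ (yes _) (no _)  ¬pq = refl
⟦⟧-⊎ (no _)  (yes _) ¬pq = refl
⟦⟧-⊎ (no _)  (no _)  ¬pq = refl

∑-filter : ∀ {P : Pred A _} (P? : Decidable P) xs f →
           ∑ (filter P? xs) f ≡ ∑[ x ∈ xs ] (⟦ P? x ⟧ * f x)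
∑-filter P? []       f = refl
∑-filter P? (x ∷ xs) f with does (P? x)
... | true  = cong₂ _+_ (sym (+-identityʳ (f x))) (∑-filter P? xs f)
... | false = ∑-filter P? xs f

length-filter : ∀ {P : Pred A _} (P? : Decidable P) xs →
                length (filter P? xs) ≡ ∑[ x ∈ xs ] ⟦ P? x ⟧
length-filter P? xs = begin
  length (filter P? xs)        ≡⟨ ∑-1 (filter P? xs) ⟨
  ∑[ _ ∈ filter P? xs ] 1      ≡⟨ ∑-filter P? xs _ ⟩
  ∑[ x ∈ xs ] (⟦ P? x ⟧ * 1)   ≡⟨ ∑-cong xs (λ x → *-identityʳ ⟦ P? x ⟧) ⟩
  ∑[ x ∈ xs ] ⟦ P? x ⟧         ∎

-- Sums against a Kronecker delta, and lists without repetition.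

module _ (_≟_ : DecidableEquality A) where

  ∑-δ-∉ : ∀ {x xs} → All (x ≢_) xs → ∀ (f : A → ℕ) → ∑[ y ∈ xs ] (⟦ x ≟ y ⟧ * f y) ≡ 0
  ∑-δ-∉         []         f = refl
  ∑-δ-∉ {x = x} (x≢y ∷ ps) f =
    cong₂ _+_ (cong (_* f _) (⟦⟧-false (x ≟ _) x≢y)) (∑-δ-∉ ps f)

  -- The element `x` occurs exactly once: membership gives one occurrence, and uniqueness makes
  -- every other term vanish.
  ∑-δ : ∀ {x xs} → Unique xs → x ∈ xs → ∀ (f : A → ℕ) → ∑[ y ∈ xs ] (⟦ x ≟ y ⟧ * f y) ≡ f x
  ∑-δ {x = x} (x∉ ∷ _) (here refl) f = begin
    ⟦ x ≟ x ⟧ * f x + _  ≡⟨ cong₂ _+_ (cong (_* f x) (⟦⟧-true (x ≟ x) refl)) (∑-δ-∉ x∉ f) ⟩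
    1 * f x + 0          ≡⟨ trans (+-identityʳ _) (*-identityˡ (f x)) ⟩
    f x                  ∎
  ∑-δ {x = x} (y∉ ∷ u) (there x∈) f =
    cong₂ _+_ (cong (_* f _) (⟦⟧-false (x ≟ _) (All.lookup y∉ x∈ ∘ sym))) (∑-δ u x∈ f)

  ∑-δ-1 : ∀ {x xs} → Unique xs → x ∈ xs → ∑[ y ∈ xs ] ⟦ x ≟ y ⟧ ≡ 1
  ∑-δ-1 {x} {xs} u x∈ =
    trans (∑-cong xs (λ y → sym (*-identityʳ ⟦ x ≟ y ⟧))) (∑-δ u x∈ (λ _ → 1))

-- Allows two edges, being positions, to be identified by comparing their endpoint pairs.
Unique-lookup-injective : ∀ {xs : List A} → Unique xs → ∀ i j → lookup xs i ≡ lookup xs j → i ≡ j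
Unique-lookup-injective (_ ∷ _)  zero    zero    _  = refl
Unique-lookup-injective (x∉ ∷ _) zero    (suc j) eq = ⊥-elim (All.lookup x∉ (∈-lookup j) eq)
Unique-lookup-injective (x∉ ∷ _) (suc i) zero    eq = ⊥-elim (All.lookup x∉ (∈-lookup i) (sym eq))
Unique-lookup-injective (_ ∷ u)  (suc i) (suc j) eq = cong suc (Unique-lookup-injective u i j eq)

-- Vertex lists of disjoint unions.

tabulate-+ : ∀ m {n} (f : Fin (m + n) → A) →
             tabulate f ≡ tabulate (f ∘ (_↑ˡ n)) ++ tabulate (f ∘ (m ↑ʳ_))
tabulate-+ ℕ.zero    f = refl
tabulate-+ (ℕ.suc m) f = cong (f zero ∷_) (tabulate-+ m (f ∘ suc))

-- `Q` and `_∨̇Q_` both enumerate their vertices by a bijection of this shape, so sums over their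
-- vertices split into sums over the constituents.
tabulate-⊎ : ∀ {m n} (e : A ↔ Fin m) (e′ : B ↔ Fin n) →
  tabulate (Inverse.from (↔-trans (e ⊎-↔ e′) (↔-sym +↔⊎))) ≡
  map inj₁ (tabulate (Inverse.from e)) ++ map inj₂ (tabulate (Inverse.from e′))
tabulate-⊎ {A} {B} {m} {n} e e′ = begin
  tabulate g
    ≡⟨ tabulate-+ m g ⟩
  tabulate (g ∘ (_↑ˡ n)) ++ tabulate (g ∘ (m ↑ʳ_))
    ≡⟨ cong₂ _++_ (tabulate-cong (λ i → cong h (splitAt-↑ˡ m i n)))
                  (tabulate-cong (λ i → cong h (splitAt-↑ʳ m n i))) ⟩
  tabulate (inj₁ ∘ Inverse.from e) ++ tabulate (inj₂ ∘ Inverse.from e′)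
    ≡⟨ cong₂ _++_ (map-tabulate (Inverse.from e) inj₁) (map-tabulate (Inverse.from e′) inj₂) ⟨
  map inj₁ (tabulate (Inverse.from e)) ++ map inj₂ (tabulate (Inverse.from e′))  ∎
  where
  h : Fin m ⊎ Fin n → A ⊎ B
  h = Inverse.from (e ⊎-↔ e′)

  g : Fin (m + n) → A ⊎ B
  g = Inverse.from (↔-trans (e ⊎-↔ e′) (↔-sym +↔⊎))

∑-⊎ : ∀ (xs : List A) (ys : List B) (f : A ⊎ B → ℕ) →
      ∑ (map inj₁ xs ++ map inj₂ ys) f ≡ ∑[ x ∈ xs ] f (inj₁ x) + ∑[ y ∈ ys ] f (inj₂ y)
∑-⊎ xs ys f =
  trans (∑-++ (map inj₁ xs) _ f) (cong₂ _+_ (∑-map inj₁ f xs) (∑-map inj₂ f ys))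

-- Edges, incidence and the weighted handshake identity.

module _ (G : SimpleGraph) where
  open SimpleGraph G hiding (order; size) renaming (sym to ~-sym)

  degree-∑ : ∀ v → degree v ≡ ∑[ w ∈ vertices ] ⟦ v ~? w ⟧
  degree-∑ v = length-filter (v ~?_) vertices

  length-vertices : length vertices ≡ order G
  length-vertices = length-tabulate (Inverse.from enum)

  index-injective : ∀ {u v} → index u ≡ index v → u ≡ v
  index-injective {u} {v} eq =
    trans (sym (Inverse.strictlyInverseʳ enum u))
          (trans (cong (Inverse.from enum) eq) (Inverse.strictlyInverseʳ enum v))

  vertices-unique : Unique vertices
  vertices-unique = tabulate⁺ λ {i} {j} eq →
    trans (sym (Inverse.strictlyInverseˡ enum i))
          (trans (cong index eq) (Inverse.strictlyInverseˡ enum j))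

  ∈-vertices : ∀ v → v ∈ vertices
  ∈-vertices v =
    subst (_∈ vertices) (Inverse.strictlyInverseʳ enum v) (∈-tabulate⁺ {f = Inverse.from enum} (index v))

  ordered? : ∀ u v → Dec (index u <ᶠ index v × u ~ v)
  ordered? u v = (index u <ᶠ? index v) ×-dec (u ~? v)

  -- Adjacent vertices are distinct by irreflexivity, so their indices differ and exactly one of the
  -- two orientations is the listed one.
  ordered-split : ∀ u v → ⟦ ordered? u v ⟧ + ⟦ ordered? v u ⟧ ≡ ⟦ u ~? v ⟧
  ordered-split u v = begin
    ⟦ ordered? u v ⟧ + ⟦ ordered? v u ⟧   ≡⟨ ⟦⟧-⊎ (ordered? u v) (ordered? v u) (λ (u<v , _) (v<u , _) → <-asym u<v v<u) ⟨
    ⟦ ordered? u v ⊎-dec ordered? v u ⟧   ≡⟨ ⟦⟧-⇔ (ordered? u v ⊎-dec ordered? v u) (u ~? v) [ proj₂ , ~-sym ∘ proj₂ ]′ orient ⟩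
    ⟦ u ~? v ⟧                            ∎
    where
    orient : u ~ v → (index u <ᶠ index v × u ~ v) ⊎ (index v <ᶠ index u × v ~ u)
    orient uv with <-cmp (index u) (index v)
    ... | tri< u<v _ _ = inj₁ (u<v , uv)
    ... | tri≈ _ u≡v _ = ⊥-elim (irrefl (index-injective u≡v) uv)
    ... | tri> _ _ v<u = inj₂ (v<u , ~-sym uv)

  ∑-edges : ∀ f → ∑ edges f ≡ ∑[ u ∈ vertices ] ∑[ v ∈ vertices ] (⟦ ordered? u v ⟧ * f (u , v))
  ∑-edges f = trans (∑-filter (λ (u , v) → ordered? u v) (cartesianProduct vertices vertices) f)
                    (∑-cartesianProduct vertices vertices _)

  -- Each edge is charged to its first and to its second end separately. At a fixed vertex the two
  -- charges run over the two orientations of the edges there, and `ordered-split` merges them into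
  -- the adjacency indicator.
  handshake : ∀ h → ∑[ e ∈ edges ] (h (proj₁ e) + h (proj₂ e)) ≡ ∑[ v ∈ vertices ] (degree v * h v)
  handshake h = begin
    ∑[ e ∈ edges ] (h (proj₁ e) + h (proj₂ e))
      ≡⟨ ∑-+ edges (h ∘ proj₁) (h ∘ proj₂) ⟩
    ∑ edges (h ∘ proj₁) + ∑ edges (h ∘ proj₂)
      -- Swapping the second double sum makes the weighted end the outer variable in both.
      ≡⟨ cong₂ _+_ (∑-edges (h ∘ proj₁)) (trans (∑-edges (h ∘ proj₂)) (∑-swap vertices vertices _)) ⟩
    ∑[ u ∈ vertices ] ∑[ v ∈ vertices ] (⟦ ordered? u v ⟧ * h u) +
    ∑[ u ∈ vertices ] ∑[ v ∈ vertices ] (⟦ ordered? v u ⟧ * h u)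
      ≡⟨ ∑-+ vertices _ _ ⟨
    ∑[ u ∈ vertices ] (∑[ v ∈ vertices ] (⟦ ordered? u v ⟧ * h u) +
                       ∑[ v ∈ vertices ] (⟦ ordered? v u ⟧ * h u))
      ≡⟨ ∑-cong vertices at-vertex ⟩
    ∑[ u ∈ vertices ] (degree u * h u)  ∎
    where
    at-vertex : ∀ u → ∑[ v ∈ vertices ] (⟦ ordered? u v ⟧ * h u) +
                      ∑[ v ∈ vertices ] (⟦ ordered? v u ⟧ * h u) ≡ degree u * h u
    at-vertex u = begin
      _ ≡⟨ ∑-+ vertices _ _ ⟨
      ∑[ v ∈ vertices ] (⟦ ordered? u v ⟧ * h u + ⟦ ordered? v u ⟧ * h u)
        ≡⟨ ∑-cong vertices (λ v → trans (sym (*-distribʳ-+ (h u) ⟦ ordered? u v ⟧ _))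
                                        (cong (_* h u) (ordered-split u v))) ⟩
      ∑[ v ∈ vertices ] (⟦ u ~? v ⟧ * h u)  ≡⟨ ∑-*ʳ (h u) vertices _ ⟩
      ∑[ v ∈ vertices ] ⟦ u ~? v ⟧ * h u    ≡⟨ cong (_* h u) (degree-∑ u) ⟨
      degree u * h u                        ∎

  ∑-degree : ∑ vertices degree ≡ 2 * size G
  ∑-degree = begin
    ∑ vertices degree                  ≡⟨ ∑-cong vertices (λ v → *-identityʳ (degree v)) ⟨
    -- With constant weight 1, every edge contributes `1 + 1`.
    ∑[ v ∈ vertices ] (degree v * 1)   ≡⟨ handshake (λ _ → 1) ⟨
    ∑[ _ ∈ edges ] 2                   ≡⟨ ∑-const edges 2 ⟩
    size G * 2                         ≡⟨ *-comm (size G) 2 ⟩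
    2 * size G                         ∎

  endpoints-ordered : ∀ e → let u , v = endpoints e in index u <ᶠ index v × u ~ v
  endpoints-ordered e =
    proj₂ (∈-filter⁻ (λ (u , v) → ordered? u v) {xs = cartesianProduct vertices vertices} (∈-lookup e))

  endpoints-injective : ∀ e f → endpoints e ≡ endpoints f → e ≡ f
  endpoints-injective = Unique-lookup-injective
    (filter⁺ (λ (u , v) → ordered? u v) (cartesianProduct⁺ vertices-unique vertices-unique))

  endpoints-distinct : ∀ e → proj₁ (endpoints e) ≢ proj₂ (endpoints e)
  endpoints-distinct e eq = irrefl eq (proj₂ (endpoints-ordered e))

  -- The ends of `e` are distinct, so they must fill both places of `f`; the index order fixes which
  -- end goes where, and the edge list has no repetition.
  same-ends : ∀ e f → proj₁ (endpoints e) ∈ₑ f → proj₂ (endpoints e) ∈ₑ f → e ≡ f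
  same-ends e f (inj₁ p) (inj₂ q) = endpoints-injective e f (cong₂ _,_ p q)
  same-ends e f (inj₁ p) (inj₁ q) = ⊥-elim (endpoints-distinct e (trans p (sym q)))
  same-ends e f (inj₂ p) (inj₂ q) = ⊥-elim (endpoints-distinct e (trans p (sym q)))
  -- The crossed matching would make the second end of `f` precede the first.
  same-ends e f (inj₂ p) (inj₁ q) = ⊥-elim (<-asym (proj₁ (endpoints-ordered f))
    (subst (λ (u , v) → index u <ᶠ index v) (cong₂ _,_ p q) (proj₁ (endpoints-ordered e))))

  ⟦∈ₑ⟧ : ∀ v e → ⟦ v ∈ₑ? e ⟧ ≡ ⟦ v ≟ proj₁ (endpoints e) ⟧ + ⟦ v ≟ proj₂ (endpoints e) ⟧
  ⟦∈ₑ⟧ v e = ⟦⟧-⊎ (v ≟ _) (v ≟ _) (λ p q → endpoints-distinct e (trans (sym p) q))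

  ∑-incident-edges : ∀ v → ∑[ e ∈ allFin (size G) ] ⟦ v ∈ₑ? e ⟧ ≡ degree v
  ∑-incident-edges v = begin
    ∑[ e ∈ allFin (size G) ] ⟦ v ∈ₑ? e ⟧                        ≡⟨ ∑-cong (allFin (size G)) (⟦∈ₑ⟧ v) ⟩
    _                                                           ≡⟨ ∑-lookup edges _ ⟩
    ∑[ e ∈ edges ] (⟦ v ≟ proj₁ e ⟧ + ⟦ v ≟ proj₂ e ⟧)          ≡⟨ handshake (λ w → ⟦ v ≟ w ⟧) ⟩
    ∑[ w ∈ vertices ] (degree w * ⟦ v ≟ w ⟧)                    ≡⟨ ∑-cong vertices (λ w → *-comm (degree w) _) ⟩
    ∑[ w ∈ vertices ] (⟦ v ≟ w ⟧ * degree w)                    ≡⟨ ∑-δ _≟_ vertices-unique (∈-vertices v) degree ⟩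
    degree v                                                    ∎

  ∑-ends : ∀ e → ∑[ v ∈ vertices ] ⟦ v ∈ₑ? e ⟧ ≡ 2
  ∑-ends e = begin
    -- The equality tests are flipped because the delta sums need the summation variable on the
    -- right.
    ∑[ v ∈ vertices ] ⟦ v ∈ₑ? e ⟧                 ≡⟨ ∑-cong vertices (λ v → trans (⟦∈ₑ⟧ v e) (cong₂ _+_ (≟-comm v a) (≟-comm v b))) ⟩
    ∑[ v ∈ vertices ] (⟦ a ≟ v ⟧ + ⟦ b ≟ v ⟧)     ≡⟨ ∑-+ vertices _ _ ⟩
    ∑[ v ∈ vertices ] ⟦ a ≟ v ⟧ + ∑[ v ∈ vertices ] ⟦ b ≟ v ⟧
      ≡⟨ cong₂ _+_ (∑-δ-1 _≟_ vertices-unique (∈-vertices a)) (∑-δ-1 _≟_ vertices-unique (∈-vertices b)) ⟩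
    2                                             ∎
    where
    a = proj₁ (endpoints e)
    b = proj₂ (endpoints e)

    ≟-comm : ∀ u v → ⟦ u ≟ v ⟧ ≡ ⟦ v ≟ u ⟧
    ≟-comm u v = ⟦⟧-⇔ (u ≟ v) (v ≟ u) sym sym

  -- An edge f ≠ e meets at most one end of e, while e itself meets both.
  ⟦adjacentEdges⟧ : ∀ e f → ⟦ adjacentEdges? e f ⟧ + 2 * ⟦ e ≟ᶠ f ⟧ ≡
                    ⟦ proj₁ (endpoints e) ∈ₑ? f ⟧ + ⟦ proj₂ (endpoints e) ∈ₑ? f ⟧
  ⟦adjacentEdges⟧ e f = by-cases (e ≟ᶠ f)
    where
    a = proj₁ (endpoints e)
    b = proj₂ (endpoints e)

    by-cases : Dec (e ≡ f) → ⟦ adjacentEdges? e f ⟧ + 2 * ⟦ e ≟ᶠ f ⟧ ≡ ⟦ a ∈ₑ? f ⟧ + ⟦ b ∈ₑ? f ⟧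
    by-cases (yes refl) = begin
      ⟦ adjacentEdges? e e ⟧ + 2 * ⟦ e ≟ᶠ e ⟧
        ≡⟨ cong₂ (λ x y → x + 2 * y) (⟦⟧-false (adjacentEdges? e e) (λ (e≢e , _) → e≢e refl))
                                     (⟦⟧-true (e ≟ᶠ e) refl) ⟩
      2 ≡⟨ cong₂ _+_ (⟦⟧-true (a ∈ₑ? e) (inj₁ refl)) (⟦⟧-true (b ∈ₑ? e) (inj₂ refl)) ⟨
      ⟦ a ∈ₑ? e ⟧ + ⟦ b ∈ₑ? e ⟧  ∎
    by-cases (no e≢f) = begin
      ⟦ adjacentEdges? e f ⟧ + 2 * ⟦ e ≟ᶠ f ⟧
        ≡⟨ cong (λ y → ⟦ adjacentEdges? e f ⟧ + 2 * y) (⟦⟧-false (e ≟ᶠ f) e≢f) ⟩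
      ⟦ adjacentEdges? e f ⟧ + 0
        ≡⟨ +-identityʳ _ ⟩
      ⟦ adjacentEdges? e f ⟧
        ≡⟨ ⟦⟧-⇔ (adjacentEdges? e f) (a ∈ₑ? f ⊎-dec b ∈ₑ? f) meets (λ p → e≢f , adjacent p) ⟩
      ⟦ a ∈ₑ? f ⊎-dec b ∈ₑ? f ⟧
        ≡⟨ ⟦⟧-⊎ (a ∈ₑ? f) (b ∈ₑ? f) (λ p q → e≢f (same-ends e f p q)) ⟩
      ⟦ a ∈ₑ? f ⟧ + ⟦ b ∈ₑ? f ⟧  ∎
      where
      meets : AdjacentEdges e f → a ∈ₑ f ⊎ b ∈ₑ f
      meets (_ , _ , inj₁ refl , p) = inj₁ p
      meets (_ , _ , inj₂ refl , q) = inj₂ q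

      adjacent : a ∈ₑ f ⊎ b ∈ₑ f → ∃ λ v → v ∈ₑ e × v ∈ₑ f
      adjacent (inj₁ p) = a , inj₁ refl , p
      adjacent (inj₂ q) = b , inj₂ refl , q

  -- The edges at the two ends number d(u) + d(v), with `e` itself counted twice. The 2 stands on
  -- the left to avoid truncated subtraction.
  ∑-adjacentEdges : ∀ e → ∑[ f ∈ allFin (size G) ] ⟦ adjacentEdges? e f ⟧ + 2 ≡
                    degree (proj₁ (endpoints e)) + degree (proj₂ (endpoints e))
  ∑-adjacentEdges e = begin
    ∑ es adj + 2
      -- The 2 is spread over all edges as twice the delta at `e`, so that the identity can be
      -- checked edge by edge.
      ≡⟨ cong (λ n → ∑ es adj + 2 * n) (∑-δ-1 _≟ᶠ_ (allFin⁺ _) (∈-allFin e)) ⟨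
    ∑ es adj + 2 * ∑[ f ∈ es ] ⟦ e ≟ᶠ f ⟧
      ≡⟨ cong (∑ es adj +_) (∑-*ˡ 2 es _) ⟨
    ∑ es adj + ∑[ f ∈ es ] (2 * ⟦ e ≟ᶠ f ⟧)
      ≡⟨ ∑-+ es adj _ ⟨
    ∑[ f ∈ es ] (adj f + 2 * ⟦ e ≟ᶠ f ⟧)
      ≡⟨ ∑-cong es (⟦adjacentEdges⟧ e) ⟩
    ∑[ f ∈ es ] (⟦ proj₁ (endpoints e) ∈ₑ? f ⟧ + ⟦ proj₂ (endpoints e) ∈ₑ? f ⟧)
      ≡⟨ ∑-+ es _ _ ⟩
    ∑[ f ∈ es ] ⟦ proj₁ (endpoints e) ∈ₑ? f ⟧ + ∑[ f ∈ es ] ⟦ proj₂ (endpoints e) ∈ₑ? f ⟧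
      ≡⟨ cong₂ _+_ (∑-incident-edges _) (∑-incident-edges _) ⟩
    degree (proj₁ (endpoints e)) + degree (proj₂ (endpoints e))  ∎
    where
    es = allFin (size G)

    adj : E → ℕ
    adj f = ⟦ adjacentEdges? e f ⟧

  -- Degrees in Q(G).

  private module Q = SimpleGraph (Q G)

  ∑-vertices-Q : ∀ f → ∑ Q.vertices f ≡ ∑[ v ∈ vertices ] f (inj₁ v) + ∑[ e ∈ allFin (size G) ] f (inj₂ e)
  -- The type `E` is already a `Fin`, so the inserted vertices are enumerated by the identity, which
  -- yields `allFin`.
  ∑-vertices-Q f = trans (cong (λ xs → ∑ xs f) (tabulate-⊎ enum ↔-refl)) (∑-⊎ vertices (allFin (size G)) f)

  degree-Q-vertex : ∀ v → Q.degree (inj₁ v) ≡ degree v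
  degree-Q-vertex v = begin
    Q.degree (inj₁ v)                                     ≡⟨ length-filter (inj₁ v Q.~?_) Q.vertices ⟩
    ∑[ x ∈ Q.vertices ] ⟦ inj₁ v Q.~? x ⟧                 ≡⟨ ∑-vertices-Q _ ⟩
    ∑[ _ ∈ vertices ] 0 + ∑[ e ∈ allFin (size G) ] ⟦ v ∈ₑ? e ⟧
      ≡⟨ cong₂ _+_ (∑-0 vertices) (∑-incident-edges v) ⟩
    degree v                                              ∎

  degree-Q-edge : ∀ e → Q.degree (inj₂ e) ≡ degree (proj₁ (endpoints e)) + degree (proj₂ (endpoints e))
  degree-Q-edge e = begin
    Q.degree (inj₂ e)                                     ≡⟨ length-filter (inj₂ e Q.~?_) Q.vertices ⟩
    ∑[ x ∈ Q.vertices ] ⟦ inj₂ e Q.~? x ⟧                 ≡⟨ ∑-vertices-Q _ ⟩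
    -- The two ends of `e`, as neighbours in Q(G), supply exactly the 2 that `∑-adjacentEdges` asks
    -- for.
    ∑[ v ∈ vertices ] ⟦ v ∈ₑ? e ⟧ + adjacent              ≡⟨ cong (_+ adjacent) (∑-ends e) ⟩
    2 + adjacent                                          ≡⟨ +-comm 2 adjacent ⟩
    adjacent + 2                                          ≡⟨ ∑-adjacentEdges e ⟩
    degree (proj₁ (endpoints e)) + degree (proj₂ (endpoints e))  ∎
    where
    adjacent = ∑[ f ∈ allFin (size G) ] ⟦ adjacentEdges? e f ⟧

  -- Sums of cubed degrees.

  -- Serves both sides of the join: `G₁` shifted by n₂ and `G₂` shifted by n₁.
  ∑-shifted-degree³ : ∀ n → ∑[ v ∈ vertices ] ((degree v + n) ^ 3) ≡
    F G + 3 * n * M₁ G + 3 * n ^ 2 * (2 * size G) + order G * n ^ 3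
  ∑-shifted-degree³ n = begin
    ∑[ v ∈ vertices ] ((degree v + n) ^ 3)
      ≡⟨ ∑-cong vertices (λ v → cube (degree v) n) ⟩
    ∑[ v ∈ vertices ] (degree v ^ 3 + 3 * n * degree v ^ 2 + 3 * n ^ 2 * degree v + n ^ 3)
      ≡⟨ ∑-+ vertices _ _ ⟩
    ∑[ v ∈ vertices ] (degree v ^ 3 + 3 * n * degree v ^ 2 + 3 * n ^ 2 * degree v) + ∑[ _ ∈ vertices ] (n ^ 3)
      ≡⟨ cong₂ _+_ (trans (∑-+ vertices _ _) (cong₂ _+_ (trans (∑-+ vertices _ _)
           (cong (F G +_) (∑-*ˡ (3 * n) vertices _))) (∑-*ˡ (3 * n ^ 2) vertices degree)))
           (∑-const vertices (n ^ 3)) ⟩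
    F G + 3 * n * M₁ G + 3 * n ^ 2 * ∑ vertices degree + length vertices * n ^ 3
      ≡⟨ cong₂ (λ x y → F G + 3 * n * M₁ G + 3 * n ^ 2 * x + y * n ^ 3) ∑-degree length-vertices ⟩
    F G + 3 * n * M₁ G + 3 * n ^ 2 * (2 * size G) + order G * n ^ 3  ∎
    where
    cube : ∀ d n → (d + n) ^ 3 ≡ d ^ 3 + 3 * n * d ^ 2 + 3 * n ^ 2 * d + n ^ 3
    cube = solve 2 (λ d n → (d :+ n) :^ 3 := d :^ 3 :+ con 3 :* n :* d :^ 2 :+ con 3 :* n :^ 2 :* d :+ n :^ 3) refl

  -- The mixed terms of the cube are 3ab(a + b), the summand of `ReZM`; the pure cubes are a
  -- handshake sum.
  ∑-edge-degree³ : ∑[ e ∈ edges ] ((degree (proj₁ e) + degree (proj₂ e)) ^ 3) ≡ M₄ G + 3 * ReZM G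
  ∑-edge-degree³ = begin
    ∑[ e ∈ edges ] ((degree (proj₁ e) + degree (proj₂ e)) ^ 3)
      ≡⟨ ∑-cong edges (λ e → cube (degree (proj₁ e)) (degree (proj₂ e))) ⟩
    ∑[ e ∈ edges ] (degree (proj₁ e) ^ 3 + degree (proj₂ e) ^ 3 + 3 * reZM e)
      ≡⟨ ∑-+ edges _ _ ⟩
    ∑[ e ∈ edges ] (degree (proj₁ e) ^ 3 + degree (proj₂ e) ^ 3) + ∑[ e ∈ edges ] (3 * reZM e)
      -- The weight `degree v ^ 3` produces `degree v * degree v ^ 3`, which is `degree v ^ 4` by
      -- definition.
      ≡⟨ cong₂ _+_ (handshake (λ v → degree v ^ 3)) (∑-*ˡ 3 edges reZM) ⟩
    M₄ G + 3 * ReZM G  ∎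
    where
    reZM : V × V → ℕ
    reZM (u , v) = degree u * degree v * (degree u + degree v)

    cube : ∀ a b → (a + b) ^ 3 ≡ a ^ 3 + b ^ 3 + 3 * (a * b * (a + b))
    cube = solve 2 (λ a b → (a :+ b) :^ 3 := a :^ 3 :+ b :^ 3 :+ con 3 :* (a :* b :* (a :+ b))) refl

-- Degrees in the vertex Q-join.

module _ (G₁ G₂ : SimpleGraph) where
  private
    module G₁ = SimpleGraph G₁
    module G₂ = SimpleGraph G₂
    module Q₁ = SimpleGraph (Q G₁)
    module J  = SimpleGraph (G₁ ∨̇Q G₂)

  ∑-vertices-join : ∀ f → ∑ J.vertices f ≡ ∑[ x ∈ Q₁.vertices ] f (inj₁ x) + ∑[ y ∈ G₂.vertices ] f (inj₂ y)
  ∑-vertices-join f = trans (cong (λ xs → ∑ xs f) (tabulate-⊎ Q₁.enum G₂.enum)) (∑-⊎ Q₁.vertices G₂.vertices f)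

  degree-join : ∀ x → J.degree x ≡ ∑[ y ∈ Q₁.vertices ] ⟦ x J.~? inj₁ y ⟧ + ∑[ y ∈ G₂.vertices ] ⟦ x J.~? inj₂ y ⟧
  degree-join x = trans (length-filter (x J.~?_) J.vertices) (∑-vertices-join _)

  degree-join-vertex : ∀ v → J.degree (inj₁ (inj₁ v)) ≡ G₁.degree v + order G₂
  degree-join-vertex v = trans (degree-join (inj₁ (inj₁ v))) (cong₂ _+_
    -- Among the vertices of Q(G₁), adjacency in the join is that of Q(G₁), so this part is a degree
    -- there; every vertex of `G₂` then adds 1.
    (trans (sym (degree-∑ (Q G₁) (inj₁ v))) (degree-Q-vertex G₁ v))
    (trans (∑-1 G₂.vertices) (length-vertices G₂)))

  degree-join-edge : ∀ e → J.degree (inj₁ (inj₂ e)) ≡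
                     G₁.degree (proj₁ (G₁.endpoints e)) + G₁.degree (proj₂ (G₁.endpoints e))
  degree-join-edge e = trans (degree-join (inj₁ (inj₂ e))) (trans (cong₂ _+_
    (trans (sym (degree-∑ (Q G₁) (inj₂ e))) (degree-Q-edge G₁ e))
    (∑-0 G₂.vertices)) (+-identityʳ _))

  degree-join-right : ∀ w → J.degree (inj₂ w) ≡ G₂.degree w + order G₁
  degree-join-right w = begin
    J.degree (inj₂ w)
      ≡⟨ degree-join (inj₂ w) ⟩
    ∑[ y ∈ Q₁.vertices ] ⟦ inj₂ w J.~? inj₁ y ⟧ + ∑[ y ∈ G₂.vertices ] ⟦ w G₂.~? y ⟧
      ≡⟨ cong₂ _+_ (∑-vertices-Q G₁ _) (sym (degree-∑ G₂ w)) ⟩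
    -- Original vertices of `G₁` are all neighbours of `w`, inserted ones never.
    ∑[ _ ∈ G₁.vertices ] 1 + ∑[ _ ∈ allFin (size G₁) ] 0 + G₂.degree w
      ≡⟨ cong (_+ G₂.degree w) (cong₂ _+_ (trans (∑-1 G₁.vertices) (length-vertices G₁)) (∑-0 (allFin (size G₁)))) ⟩
    order G₁ + 0 + G₂.degree w
      ≡⟨ trans (cong (_+ G₂.degree w) (+-identityʳ _)) (+-comm (order G₁) _) ⟩
    G₂.degree w + order G₁  ∎

  -- The three sums come from the three kinds of vertex: original in `G₁`, inserted, and in `G₂`.
  -- The middle one is already evaluated by `∑-edge-degree³`.
  F-join : F (G₁ ∨̇Q G₂) ≡
    ∑[ v ∈ G₁.vertices ] ((G₁.degree v + order G₂) ^ 3) + (M₄ G₁ + 3 * ReZM G₁) +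
    ∑[ w ∈ G₂.vertices ] ((G₂.degree w + order G₁) ^ 3)
  F-join = begin
    F (G₁ ∨̇Q G₂)
      ≡⟨ trans (∑-vertices-join _) (cong (_+ ∑[ w ∈ G₂.vertices ] (J.degree (inj₂ w) ^ 3)) (∑-vertices-Q G₁ _)) ⟩
    ∑[ v ∈ G₁.vertices ] (J.degree (inj₁ (inj₁ v)) ^ 3) + ∑[ e ∈ allFin (size G₁) ] (J.degree (inj₁ (inj₂ e)) ^ 3) +
    ∑[ w ∈ G₂.vertices ] (J.degree (inj₂ w) ^ 3)
      ≡⟨ cong₂ _+_ (cong₂ _+_
           (∑-cong G₁.vertices (λ v → cong (_^ 3) (degree-join-vertex v)))
           (trans (∑-cong (allFin (size G₁)) (λ e → cong (_^ 3) (degree-join-edge e)))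
                  (trans (∑-lookup G₁.edges _) (∑-edge-degree³ G₁))))
           (∑-cong G₂.vertices (λ w → cong (_^ 3) (degree-join-right w))) ⟩
    _ ∎

theorem5 : (G₁ G₂ : SimpleGraph) → Connected G₁ → Connected G₂ →
    (n₁ n₂ m₁ m₂ : ℕ) →
    order G₁ ≡ n₁ → order G₂ ≡ n₂ → size G₁ ≡ m₁ → size G₂ ≡ m₂ →
    F (G₁ ∨̇Q G₂) ≡
    F G₁ + F G₂ + 3 * n₂ * M₁ G₁ + 3 * n₁ * M₁ G₂ + M₄ G₁ + 3 * ReZM G₁
    + 6 * m₁ * n₂ ^ 2 + 6 * m₂ * n₁ ^ 2 + n₁ * n₂ * (n₁ ^ 2 + n₂ ^ 2)
theorem5 G₁ G₂ _ _ n₁ n₂ m₁ m₂ refl refl refl refl = begin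
  F (G₁ ∨̇Q G₂)
    ≡⟨ F-join G₁ G₂ ⟩
  _ ≡⟨ cong₂ (λ x y → x + (M₄ G₁ + 3 * ReZM G₁) + y) (∑-shifted-degree³ G₁ n₂) (∑-shifted-degree³ G₂ n₁) ⟩
  _ ≡⟨ collect (F G₁) (F G₂) (M₁ G₁) (M₁ G₂) (M₄ G₁) (ReZM G₁) n₁ n₂ m₁ m₂ ⟩
  _ ∎
  where
  -- A polynomial identity: the linear degree terms 3n²(2m) become 6mn², and the two constant terms
  -- n₁n₂³ and n₂n₁³ share the factor n₁n₂.
  collect : ∀ f₁ f₂ a₁ a₂ b r n₁ n₂ m₁ m₂ →
    f₁ + 3 * n₂ * a₁ + 3 * n₂ ^ 2 * (2 * m₁) + n₁ * n₂ ^ 3 + (b + 3 * r) +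
    (f₂ + 3 * n₁ * a₂ + 3 * n₁ ^ 2 * (2 * m₂) + n₂ * n₁ ^ 3) ≡
    f₁ + f₂ + 3 * n₂ * a₁ + 3 * n₁ * a₂ + b + 3 * r
    + 6 * m₁ * n₂ ^ 2 + 6 * m₂ * n₁ ^ 2 + n₁ * n₂ * (n₁ ^ 2 + n₂ ^ 2)
  collect = solve 10 (λ f₁ f₂ a₁ a₂ b r n₁ n₂ m₁ m₂ →
    f₁ :+ con 3 :* n₂ :* a₁ :+ con 3 :* n₂ :^ 2 :* (con 2 :* m₁) :+ n₁ :* n₂ :^ 3 :+ (b :+ con 3 :* r) :+
    (f₂ :+ con 3 :* n₁ :* a₂ :+ con 3 :* n₁ :^ 2 :* (con 2 :* m₂) :+ n₂ :* n₁ :^ 3) :=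
    f₁ :+ f₂ :+ con 3 :* n₂ :* a₁ :+ con 3 :* n₁ :* a₂ :+ b :+ con 3 :* r
    :+ con 6 :* m₁ :* n₂ :^ 2 :+ con 6 :* m₂ :* n₁ :^ 2 :+ n₁ :* n₂ :* (n₁ :^ 2 :+ n₂ :^ 2)) refl
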